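{- Let $d\geq 3$ and $n\geq 2(d+1)$. Let $G\in\mathcal{G}_{n,d}$ and let $v$ be any vertex of $G$, and let $S={\rm N}_G[v]$ be the closed neighbourhood of $v$ in $G$. Then there is a sequence of $\Delta$-switches starting from $G$ which ends in a graph $G'\in\mathcal{G}_{n,d}$ in which $S$ is the vertex set of a connected component of $G'$ that is a complete graph (isomorphic to $K_{d+1}$).
   Context: All graphs are simple. $\mathcal{G}_{n,d}$ denotes the set of all $d$-regular graphs with vertex set $[n]$. ${\rm N}_G[v]={\rm N}_G(v)\cup\{v\}$ where ${\rm N}_G(v)$ is the set of neighbours of $v$. A $\Delta^+$-switch in a graph $G=(V,E)$: if $v,x,y,w,z$ are distinct vertices such that $yx, xv, vw, wz\in E$ and $xw, yz\notin E$, delete the edges $xy$, $wz$ and insert the edges $xw$, $yz$. A $\Delta^-$-switch is the reverse operation: if $v,x,y,w,z$ are distinct, $G$ contains the triangle on $v,x,w$ and the edge $yz$, and $xy, wz\notin E$, delete $xw$, $yz$ and insert $xy$, $wz$. A $\Delta$-switch is a $\Delta^+$-switch or a $\Delta^-$-switch. -}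

module Defs where

open import Data.Nat using (ℕ; _+_)
open import Data.Bool using (Bool; true; false; if_then_else_; _∨_; _∧_)
open import Data.Fin using (Fin)
open import Data.Fin.Properties using (_≟_)
open import Data.List using (List; map; allFin)
open import Data.Nat.ListAction using (sum)
open import Data.Product using (_×_; ∃-syntax)
open import Data.Sum using (_⊎_)
open import Relation.Nullary using (¬_)
open import Relation.Nullary.Decidable using (⌊_⌋)
open import Relation.Binary.PropositionalEquality using (_≡_)
open import Relation.Binary.Construct.Closure.ReflexiveTransitive using (Star)

record Graph (n : ℕ) : Set where
  field
    adj : Fin n → Fin n → Bool
    adj-sym : ∀ i j → adj i j ≡ adj j i
    adj-irr : ∀ i → adj i i ≡ false
open Graph public

deg : ∀ {n} → Graph n → Fin n → ℕ
deg {n} G i = sum (map (λ j → if adj G i j then 1 else 0) (allFin n))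

Regular : ∀ {n} → ℕ → Graph n → Set
Regular d G = ∀ i → deg G i ≡ d

samePair : ∀ {n} → Fin n → Fin n → Fin n → Fin n → Bool
samePair p q a b = (⌊ p ≟ a ⌋ ∧ ⌊ q ≟ b ⌋) ∨ (⌊ p ≟ b ⌋ ∧ ⌊ q ≟ a ⌋)

Distinct5 : ∀ {n} → Fin n → Fin n → Fin n → Fin n → Fin n → Set
Distinct5 v x y w z =
  ¬ v ≡ x × ¬ v ≡ y × ¬ v ≡ w × ¬ v ≡ z ×
  ¬ x ≡ y × ¬ x ≡ w × ¬ x ≡ z ×
  ¬ y ≡ w × ¬ y ≡ z ×
  ¬ w ≡ z

Replaces : ∀ {n} → Graph n → Graph n →
           (a b c d e f g h : Fin n) → Set
Replaces G H a b c d e f g h =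
  ∀ p q → adj H p q ≡
    (if samePair p q a b ∨ samePair p q c d then false
     else if samePair p q e f ∨ samePair p q g h then true
     else adj G p q)

ΔPlus : ∀ {n} → Graph n → Graph n → Set
ΔPlus G H = ∃[ v ] ∃[ x ] ∃[ y ] ∃[ w ] ∃[ z ]
  ( Distinct5 v x y w z
  × adj G y x ≡ true × adj G x v ≡ true × adj G v w ≡ true × adj G w z ≡ true
  × adj G x w ≡ false × adj G y z ≡ false
  × Replaces G H x y w z x w y z )

ΔMinus : ∀ {n} → Graph n → Graph n → Set
ΔMinus G H = ∃[ v ] ∃[ x ] ∃[ y ] ∃[ w ] ∃[ z ]
  ( Distinct5 v x y w z
  × adj G v x ≡ true × adj G x w ≡ true × adj G v w ≡ true × adj G y z ≡ true
  × adj G x y ≡ false × adj G w z ≡ false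
  × Replaces G H x w y z x y w z )

ΔSwitch : ∀ {n} → Graph n → Graph n → Set
ΔSwitch G H = ΔPlus G H ⊎ ΔMinus G H

ΔSwitches : ∀ {n} → Graph n → Graph n → Set
ΔSwitches = Star ΔSwitch

InClosedNbhd : ∀ {n} → Graph n → Fin n → Fin n → Set
InClosedNbhd G v a = a ≡ v ⊎ adj G v a ≡ true

CompleteComponent : ∀ {n} → Graph n → (Fin n → Set) → Set
CompleteComponent {n} H S =
  (∀ a b → S a → S b → ¬ a ≡ b → adj H a b ≡ true) ×
  (∀ a b → S a → ¬ S b → adj H a b ≡ false)

{-# OPTIONS --safe #-}

-- Write N for the neighbourhood of v in G, and call a vertex outer if it is neither v nor in N.  Every
-- switch used below avoids v and deletes only edges with an outer end, so N stays fixed and the edges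
-- inside N only grow; it suffices to join one non-adjacent pair x, w of N at a time.  By regularity
-- x and w have outer neighbours y and z.  If y ≠ z and yz is not an edge, a Δ⁺-switch centred at v
-- joins x and w.  If yz is an edge, a preliminary Δ-switch either deletes it or trades y for another
-- outer neighbour of x that is distinct from z and not adjacent to it.  If y = z is the only outer
-- neighbour of both x and w, then x and w are adjacent to all other vertices of N, and a preliminary
-- Δ-switch changes the outer neighbour of x.  All auxiliary vertices come from one counting principle:
-- if a has a neighbour outside N[b], then b has a neighbour outside N[a]; similarly for two neighbours.
-- The bound on n only serves to find a vertex outside N[v] ∪ N[y].
module Submission where

open import Defs
open import Algebra.Properties.CommutativeSemigroup using (interchange)
open import Data.Bool using (Bool; true; false; if_then_else_; _∨_; _∧_; not)
import Data.Bool.Properties as Bool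
open import Data.Fin using (Fin; zero; suc)
open import Data.Fin.Properties using (_≟_; any?)
open import Data.List using (List; []; _∷_; map; allFin; cartesianProduct)
open import Data.List.Membership.Propositional.Properties using (∈-allFin; ∈-cartesianProduct⁺)
open import Data.List.Properties using (map-tabulate)
open import Data.List.Relation.Unary.All as All using (All; []; _∷_)
open import Data.Nat using (ℕ; zero; suc; _≤_; _*_; _+_; z≤n)
open import Data.Nat.ListAction using (sum)
open import Data.Nat.Properties
  using (≤-pred; ≤-refl; ≤-reflexive; ≤-trans; <-irrefl; suc-injective; +-suc; +-comm; +-mono-≤; m≤m+n;
         +-commutativeSemigroup; module ≤-Reasoning)
open import Data.Nat.Solver using (module +-*-Solver)
open import Data.Product using (_×_; _,_; proj₁; proj₂; ∃-syntax)
open import Data.Sum using (_⊎_; inj₁; inj₂; [_,_]′)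
open import Function using (_∘_; id)
open import Relation.Binary.Construct.Closure.ReflexiveTransitive using (ε; _◅_; _◅◅_)
open import Relation.Binary.PropositionalEquality
  using (_≡_; refl; sym; trans; cong; cong₂; subst; ≢-sym; module ≡-Reasoning)
open import Relation.Nullary using (¬_; Dec; yes; no; does; contradiction)
open import Relation.Nullary.Decidable using (_×-dec_; ¬?; ⌊_⌋; decidable-stable)

-- Counting with Boolean predicates

private
  variable
    n d : ℕ

indicator : Bool → ℕ
indicator b = if b then 1 else 0

# : (Fin n → Bool) → ℕ
# f = sum (map (λ j → indicator (f j)) (allFin _))

#-suc : (f : Fin (suc n) → Bool) → # f ≡ indicator (f zero) + # (f ∘ suc)
#-suc f = cong (λ l → indicator (f zero) + sum l)
  (trans (map-tabulate suc (indicator ∘ f)) (sym (map-tabulate id (indicator ∘ f ∘ suc))))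

indicator-mono : ∀ {b c} → (b ≡ true → c ≡ true) → indicator b ≤ indicator c
indicator-mono {false} _ = z≤n
indicator-mono {true}  h rewrite h refl = ≤-refl

#-mono : {f g : Fin n → Bool} → (∀ j → f j ≡ true → g j ≡ true) → # f ≤ # g
#-mono {zero}          h = z≤n
#-mono {suc n} {f} {g} h rewrite #-suc f | #-suc g =
  +-mono-≤ (indicator-mono (h zero)) (#-mono (h ∘ suc))

#-cong : {f g : Fin n → Bool} → (∀ j → f j ≡ g j) → # f ≡ # g
#-cong {zero}          h = refl
#-cong {suc n} {f} {g} h rewrite #-suc f | #-suc g =
  cong₂ (λ b m → indicator b + m) (h zero) (#-cong (h ∘ suc))

#-cover : (f g : Fin n → Bool) → (∀ j → f j ≡ true ⊎ g j ≡ true) → n ≤ # f + # g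
#-cover {zero}  f g h = z≤n
#-cover {suc n} f g h rewrite #-suc f | #-suc g = begin
  1 + n                                                     ≤⟨ +-mono-≤ (head (h zero)) (#-cover _ _ (h ∘ suc)) ⟩
  (indicator (f zero) + indicator (g zero)) + (# (f ∘ suc) + # (g ∘ suc))
    ≡⟨ interchange +-commutativeSemigroup (indicator (f zero)) (indicator (g zero)) (# (f ∘ suc)) (# (g ∘ suc)) ⟩
  (indicator (f zero) + # (f ∘ suc)) + (indicator (g zero) + # (g ∘ suc)) ∎
  where
  open ≤-Reasoning
  head : ∀ {b c} → b ≡ true ⊎ c ≡ true → 1 ≤ indicator b + indicator c
  head (inj₁ refl) = m≤m+n 1 _
  head {b} (inj₂ refl) = ≤-trans (m≤m+n 1 _) (≤-reflexive (+-comm 1 (indicator b)))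

separated : (f : Fin n → Bool) {i j : Fin n} → f i ≡ true → f j ≡ false → ¬ i ≡ j
separated f fi fj refl = contradiction (trans (sym fi) fj) λ ()

infixl 6 _∖_

_∖_ : (Fin n → Bool) → Fin n → Fin n → Bool
(f ∖ c) j = f j ∧ not (does (j ≟ c))

∈∖⁺ : (f : Fin n → Bool) {c j : Fin n} → f j ≡ true → ¬ j ≡ c → (f ∖ c) j ≡ true
∈∖⁺ f {c} {j} fj j≢c with j ≟ c
... | yes j≡c = contradiction j≡c j≢c
... | no  _   = trans (Bool.∧-identityʳ (f j)) fj

∈∖⁻ : (f : Fin n → Bool) {c j : Fin n} → (f ∖ c) j ≡ true → f j ≡ true × ¬ j ≡ c
∈∖⁻ f {c} {j} h with f j | j ≟ c
... | true | no j≢c = refl , j≢c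

∉∖⁺ : (f : Fin n → Bool) {c j : Fin n} → f j ≡ false → (f ∖ c) j ≡ false
∉∖⁺ f fj rewrite fj = refl

∉∖⁻ : (f : Fin n → Bool) {c j : Fin n} → (f ∖ c) j ≡ false → ¬ j ≡ c → f j ≡ false
∉∖⁻ f {c} {j} h j≢c with j ≟ c
... | yes j≡c = contradiction j≡c j≢c
... | no  _   = trans (sym (Bool.∧-identityʳ (f j))) h

∖-absent : (f : Fin n → Bool) {c : Fin n} → f c ≡ false → ∀ j → (f ∖ c) j ≡ f j
∖-absent f {c} fc j with j ≟ c
... | yes refl rewrite fc = refl
... | no  _    = Bool.∧-identityʳ (f j)

#-∖ : (f : Fin n → Bool) {c : Fin n} → f c ≡ true → # f ≡ suc (# (f ∖ c))
#-∖ {suc n} f {zero} fc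
  rewrite #-suc f | #-suc (f ∖ zero) | fc =
  cong suc (#-cong (λ j → sym (Bool.∧-identityʳ (f (suc j)))))
#-∖ {suc n} f {suc c} fc
  rewrite #-suc f | #-suc (f ∖ suc c) | Bool.∧-identityʳ (f zero) =
  trans (cong (indicator (f zero) +_) (#-∖ (f ∘ suc) fc)) (+-suc (indicator (f zero)) _)

-- With `b` removed from `f` and `c` from `g`, the two predicates agree everywhere.
#-trade : (f g : Fin n → Bool) {b c : Fin n} → f b ≡ true → f c ≡ false → g c ≡ true → g b ≡ false →
  (∀ j → ¬ j ≡ b → ¬ j ≡ c → f j ≡ g j) → # f ≡ # g
#-trade f g {b} {c} fb fc gc gb agree = begin
  # f              ≡⟨ #-∖ f fb ⟩
  suc (# (f ∖ b))  ≡⟨ cong suc (#-cong rest) ⟩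
  suc (# (g ∖ c))  ≡⟨ sym (#-∖ g gc) ⟩
  # g              ∎
  where
  open ≡-Reasoning
  rest : ∀ j → (f ∖ b) j ≡ (g ∖ c) j
  rest j with j ≟ b | j ≟ c
  ... | yes refl | _        = trans (Bool.∧-zeroʳ (f j)) (sym (cong (_∧ _) gb))
  ... | no _     | yes refl = trans (cong (_∧ true) fc) (sym (Bool.∧-zeroʳ (g j)))
  ... | no j≢b   | no j≢c   = cong (_∧ true) (agree j j≢b j≢c)

-- Otherwise `g` would be contained in `f` without `c`, hence be strictly smaller.
#-exchange : (f g : Fin n → Bool) → # f ≡ # g → {c : Fin n} → f c ≡ true → g c ≡ false →
  ∃[ e ] (g e ≡ true × f e ≡ false)
#-exchange f g eq {c} fc gc
  with any? (λ e → (g e Bool.≟ true) ×-dec (f e Bool.≟ false))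
... | yes found = found
... | no  none  = contradiction (begin-strict
        # g        ≤⟨ #-mono within ⟩
        # (f ∖ c)  <⟨ ≤-refl ⟩
        suc (# (f ∖ c)) ≡⟨ sym (#-∖ f fc) ⟩
        # f ∎) (<-irrefl (sym eq))
  where
  open ≤-Reasoning
  within : ∀ j → g j ≡ true → (f ∖ c) j ≡ true
  within j gj with f j in fj
  ... | false = contradiction (j , gj , fj) none
  ... | true with j ≟ c
  ...   | yes refl = contradiction (trans (sym gj) gc) λ ()
  ...   | no  _    = refl

-- Remove the first exchanged pair from both sides and exchange once more.
#-exchange₂ : (f g : Fin n → Bool) → # f ≡ # g → {b c : Fin n} → ¬ b ≡ c →
  f b ≡ true → g b ≡ false → f c ≡ true → g c ≡ false →
  ∃[ e ] ∃[ h ] (¬ e ≡ h × (g e ≡ true × f e ≡ false) × (g h ≡ true × f h ≡ false))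
#-exchange₂ f g eq {b} {c} b≢c fb gb fc gc =
  let e , ge , fe = #-exchange f g eq fb gb
      h , gh , fh = #-exchange (f ∖ b) (g ∖ e)
                      (suc-injective (trans (sym (#-∖ f fb)) (trans eq (#-∖ g ge))))
                      (∈∖⁺ f fc (≢-sym b≢c)) (∉∖⁺ g gc)
      gh′ , h≢e   = ∈∖⁻ g gh
      h≢b         = separated g gh′ gb
  in e , h , ≢-sym h≢e , (ge , fe) , (gh′ , ∉∖⁻ f fh h≢b)

#-inhabited : (f : Fin n → Bool) → 1 ≤ # f → ∃[ e ] f e ≡ true
#-inhabited {suc n} f h = go (f zero) refl
  where
  go : ∀ b → f zero ≡ b → ∃[ e ] f e ≡ true
  go true  f0 = zero , f0
  go false f0 =
    let e , fe = #-inhabited (f ∘ suc)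
          (subst (1 ≤_) (trans (#-suc f) (cong (λ b → indicator b + # (f ∘ suc)) f0)) h)
    in suc e , fe

-- Adjacency and non-adjacency

Adj : Graph n → Fin n → Fin n → Set
Adj G a b = adj G a b ≡ true

-- Distinctness is included: b lies outside the closed neighbourhood of a.
NonAdj : Graph n → Fin n → Fin n → Set
NonAdj G a b = ¬ a ≡ b × adj G a b ≡ false

module _ (G : Graph n) where

  adj-symm : ∀ {a b} → Adj G a b → Adj G b a
  adj-symm {a} {b} ab = trans (adj-sym G b a) ab

  nonAdj-symm : ∀ {a b} → NonAdj G a b → NonAdj G b a
  nonAdj-symm {a} {b} (a≢b , ab) = ≢-sym a≢b , trans (adj-sym G b a) ab

  adj⇒≢ : ∀ {a b} → Adj G a b → ¬ a ≡ b
  adj⇒≢ {a} ab refl = contradiction (trans (sym ab) (adj-irr G a)) λ ()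

  adj-nonAdj⇒≢ : ∀ {a b c} → Adj G a b → NonAdj G a c → ¬ b ≡ c
  adj-nonAdj⇒≢ {a} ab (_ , ac) = separated (adj G a) ab ac

  adj-or-nonAdj : ∀ {a b} → ¬ a ≡ b → Adj G a b ⊎ NonAdj G a b
  adj-or-nonAdj {a} {b} a≢b with adj G a b
  ... | true  = inj₁ refl
  ... | false = inj₂ (a≢b , refl)

  closed : Fin n → Fin n → Bool
  closed a j = adj G a j ∨ does (j ≟ a)

  #-closed : ∀ a → # (closed a) ≡ suc (deg G a)
  #-closed a = trans (#-∖ (closed a) self) (cong suc (#-cong rest))
    where
    self : closed a a ≡ true
    self with a ≟ a
    ... | yes _   = Bool.∨-zeroʳ (adj G a a)
    ... | no  a≢a = contradiction refl a≢a
    rest : ∀ j → (closed a ∖ a) j ≡ adj G a j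
    rest j with j ≟ a
    ... | yes refl rewrite adj-irr G a = refl
    ... | no  _    = trans (Bool.∧-identityʳ _) (Bool.∨-identityʳ _)

  closed-false : ∀ {a j} → ¬ closed a j ≡ true → NonAdj G a j
  closed-false {a} {j} h with adj G a j | j ≟ a
  ... | true  | _       = contradiction refl h
  ... | false | yes _   = contradiction refl h
  ... | false | no  j≢a = ≢-sym j≢a , refl

-- Switches

SamePair : (p q a b : Fin n) → Set
SamePair p q a b = (p ≡ a × q ≡ b) ⊎ (p ≡ b × q ≡ a)

samePair-reflects : (p q a b : Fin n) →
  (samePair p q a b ≡ true × SamePair p q a b) ⊎ (samePair p q a b ≡ false × ¬ SamePair p q a b)
samePair-reflects p q a b with p ≟ a | q ≟ b | p ≟ b | q ≟ a
... | yes pa | yes qb | _      | _      = inj₁ (refl , inj₁ (pa , qb))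
... | yes _  | no  _  | yes pb | yes qa = inj₁ (refl , inj₂ (pb , qa))
... | no  _  | _      | yes pb | yes qa = inj₁ (refl , inj₂ (pb , qa))
... | yes _  | no ¬qb | no ¬pb | _      = inj₂ (refl , [ ¬qb ∘ proj₂ , ¬pb ∘ proj₁ ]′)
... | yes _  | no ¬qb | yes _  | no ¬qa = inj₂ (refl , [ ¬qb ∘ proj₂ , ¬qa ∘ proj₂ ]′)
... | no ¬pa | _      | no ¬pb | _      = inj₂ (refl , [ ¬pa ∘ proj₁ , ¬pb ∘ proj₁ ]′)
... | no ¬pa | _      | yes _  | no ¬qa = inj₂ (refl , [ ¬pa ∘ proj₁ , ¬qa ∘ proj₂ ]′)

samePair-flipˡ : (p q a b : Fin n) → samePair p q a b ≡ samePair q p a b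
samePair-flipˡ p q a b = trans (Bool.∨-comm (⌊ p ≟ a ⌋ ∧ ⌊ q ≟ b ⌋) _)
  (cong₂ _∨_ (Bool.∧-comm ⌊ p ≟ b ⌋ _) (Bool.∧-comm ⌊ p ≟ a ⌋ _))

samePair-flipʳ : (p q a b : Fin n) → samePair p q a b ≡ samePair p q b a
samePair-flipʳ p q a b = Bool.∨-comm (⌊ p ≟ a ⌋ ∧ ⌊ q ≟ b ⌋) _

module _ {p q a b : Fin n} where

  misses-first : ¬ p ≡ a → ¬ q ≡ a → ¬ SamePair p q a b
  misses-first p≢a q≢a = [ p≢a ∘ proj₁ , q≢a ∘ proj₂ ]′

  misses-second : ¬ p ≡ b → ¬ q ≡ b → ¬ SamePair p q a b
  misses-second p≢b q≢b = [ q≢b ∘ proj₂ , p≢b ∘ proj₁ ]′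

  misses-both : ¬ p ≡ a → ¬ p ≡ b → ¬ SamePair p q a b
  misses-both p≢a p≢b = [ p≢a ∘ proj₁ , p≢b ∘ proj₁ ]′

-- The switch deletes a b and c e and inserts a c and b e.
record Switchable (G : Graph n) (a b c e : Fin n) : Set where
  constructor switchable
  field
    ab : Adj G a b
    ce : Adj G c e
    ac : NonAdj G a c
    be : NonAdj G b e

-- One formula serves both kinds of Δ-switch. It has the shape of the right side of `Replaces`, so
-- the latter mostly holds by `refl`.
switchAdj : Graph n → (a b c e p q : Fin n) → Bool
switchAdj G a b c e p q =
  if samePair p q a b ∨ samePair p q c e then false
  else if samePair p q a c ∨ samePair p q b e then true
  else adj G p q

module _ (G : Graph n) where

  switchAdj-sym : ∀ a b c e p q → switchAdj G a b c e p q ≡ switchAdj G a b c e q p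
  switchAdj-sym a b c e p q
    rewrite samePair-flipˡ p q a b | samePair-flipˡ p q c e
          | samePair-flipˡ p q a c | samePair-flipˡ p q b e | adj-sym G p q = refl

  -- This symmetry and the next carry `a` to each of the four corners, so degrees need to be
  -- compared at `a` only.
  switchAdj-mirror : ∀ a b c e p q → switchAdj G a b c e p q ≡ switchAdj G b a e c p q
  switchAdj-mirror a b c e p q
    rewrite samePair-flipʳ p q a b | samePair-flipʳ p q c e
          | Bool.∨-comm (samePair p q a c) (samePair p q b e) = refl

  switchAdj-rotate : ∀ a b c e p q → switchAdj G a b c e p q ≡ switchAdj G c e a b p q
  switchAdj-rotate a b c e p q
    rewrite samePair-flipʳ p q a c | samePair-flipʳ p q b e
          | Bool.∨-comm (samePair p q a b) (samePair p q c e) = refl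

  data SwitchView (a b c e p q : Fin n) : Set where
    deleted  : SamePair p q a b ⊎ SamePair p q c e → switchAdj G a b c e p q ≡ false →
               SwitchView a b c e p q
    inserted : ¬ SamePair p q a b → ¬ SamePair p q c e → SamePair p q a c ⊎ SamePair p q b e →
               switchAdj G a b c e p q ≡ true → SwitchView a b c e p q
    kept     : ¬ SamePair p q a b → ¬ SamePair p q c e → ¬ SamePair p q a c → ¬ SamePair p q b e →
               switchAdj G a b c e p q ≡ adj G p q → SwitchView a b c e p q

  switchView : ∀ a b c e p q → SwitchView a b c e p q
  switchView a b c e p q
    with samePair-reflects p q a b | samePair-reflects p q c e
       | samePair-reflects p q a c | samePair-reflects p q b e
  ... | inj₁ (≡ab , ab) | _ | _ | _ = deleted (inj₁ ab) eq
    where eq : switchAdj G a b c e p q ≡ false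
          eq rewrite ≡ab = refl
  ... | inj₂ (≡ab , _) | inj₁ (≡ce , ce) | _ | _ = deleted (inj₂ ce) eq
    where eq : switchAdj G a b c e p q ≡ false
          eq rewrite ≡ab | ≡ce = refl
  ... | inj₂ (≡ab , ¬ab) | inj₂ (≡ce , ¬ce) | inj₁ (≡ac , ac) | _ = inserted ¬ab ¬ce (inj₁ ac) eq
    where eq : switchAdj G a b c e p q ≡ true
          eq rewrite ≡ab | ≡ce | ≡ac = refl
  ... | inj₂ (≡ab , ¬ab) | inj₂ (≡ce , ¬ce) | inj₂ (≡ac , _) | inj₁ (≡be , be) =
    inserted ¬ab ¬ce (inj₂ be) eq
    where eq : switchAdj G a b c e p q ≡ true
          eq rewrite ≡ab | ≡ce | ≡ac | ≡be = refl
  ... | inj₂ (≡ab , ¬ab) | inj₂ (≡ce , ¬ce) | inj₂ (≡ac , ¬ac) | inj₂ (≡be , ¬be) =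
    kept ¬ab ¬ce ¬ac ¬be eq
    where eq : switchAdj G a b c e p q ≡ adj G p q
          eq rewrite ≡ab | ≡ce | ≡ac | ≡be = refl

module _ {G : Graph n} where

  mirror : ∀ {a b c e} → Switchable G a b c e → Switchable G b a e c
  mirror (switchable ab ce ac be) = switchable (adj-symm G ab) (adj-symm G ce) be ac

  rotate : ∀ {a b c e} → Switchable G a b c e → Switchable G c e a b
  rotate (switchable ab ce ac be) = switchable ce ab (nonAdj-symm G ac) (nonAdj-symm G be)

module _ (G : Graph n) {a b c e : Fin n} (s : Switchable G a b c e) where
  open Switchable s

  switch : Graph n
  switch = record
    { adj     = switchAdj G a b c e
    ; adj-sym = switchAdj-sym G a b c e
    ; adj-irr = irr
    }
    where
    loop : ∀ {i p q : Fin n} → ¬ p ≡ q → ¬ SamePair i i p q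
    loop p≢q (inj₁ (refl , i≡q)) = p≢q i≡q
    loop p≢q (inj₂ (refl , i≡p)) = p≢q (sym i≡p)
    irr : ∀ i → switchAdj G a b c e i i ≡ false
    irr i with switchView G a b c e i i
    ... | deleted _ eq                 = eq
    ... | inserted _ _ (inj₁ ii-ac) _  = contradiction ii-ac (loop (proj₁ ac))
    ... | inserted _ _ (inj₂ ii-be) _  = contradiction ii-be (loop (proj₁ be))
    ... | kept _ _ _ _ eq              = trans eq (adj-irr G i)

  switch-keeps-adj : ∀ {p q} → Adj G p q → ¬ SamePair p q a b → ¬ SamePair p q c e → Adj switch p q
  switch-keeps-adj {p} {q} pq ¬ab ¬ce with switchView G a b c e p q
  ... | deleted del _      = contradiction del [ ¬ab , ¬ce ]′
  ... | inserted _ _ _ eq  = eq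
  ... | kept _ _ _ _ eq    = trans eq pq

  switch-keeps-nonAdj : ∀ {p q} → NonAdj G p q → ¬ SamePair p q a c → ¬ SamePair p q b e →
    NonAdj switch p q
  switch-keeps-nonAdj {p} {q} (p≢q , pq) ¬ac ¬be with switchView G a b c e p q
  ... | deleted _ eq         = p≢q , eq
  ... | inserted _ _ ins _   = contradiction ins [ ¬ac , ¬be ]′
  ... | kept _ _ _ _ eq      = p≢q , trans eq pq

  switch-deletes : NonAdj switch a b
  switch-deletes with switchView G a b c e a b
  ... | deleted _ eq        = adj⇒≢ G ab , eq
  ... | inserted ¬ab _ _ _  = contradiction (inj₁ (refl , refl)) ¬ab
  ... | kept ¬ab _ _ _ _    = contradiction (inj₁ (refl , refl)) ¬ab

  switch-inserts : Adj switch a c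
  switch-inserts with switchView G a b c e a c
  ... | deleted (inj₁ ac-ab) _ = contradiction ac-ab
          (misses-second (adj⇒≢ G ab) (≢-sym (adj-nonAdj⇒≢ G ab ac)))
  ... | deleted (inj₂ ac-ce) _ = contradiction ac-ce
          (misses-both (proj₁ ac) (adj-nonAdj⇒≢ G (adj-symm G ab) be))
  ... | inserted _ _ _ eq      = eq
  ... | kept _ _ ¬ac _ _       = contradiction (inj₁ (refl , refl)) ¬ac

  switch-untouched : ∀ {i} → ¬ i ≡ a → ¬ i ≡ b → ¬ i ≡ c → ¬ i ≡ e → ∀ j → adj switch i j ≡ adj G i j
  switch-untouched {i} i≢a i≢b i≢c i≢e j with switchView G a b c e i j
  ... | deleted del _       = contradiction del [ misses-both i≢a i≢b , misses-both i≢c i≢e ]′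
  ... | inserted _ _ ins _  = contradiction ins [ misses-both i≢a i≢c , misses-both i≢b i≢e ]′
  ... | kept _ _ _ _ eq     = eq

  -- At `a` the neighbour `b` is traded for `c`, and nothing else changes.
  switch-deg-corner : deg switch a ≡ deg G a
  switch-deg-corner =
    #-trade (adj switch a) (adj G a) switch-inserts (proj₂ switch-deletes) ab (proj₂ ac)
      λ j j≢c j≢b → agree j≢b j≢c (switchView G a b c e a j)
    where
    agree : ∀ {j} → ¬ j ≡ b → ¬ j ≡ c → SwitchView G a b c e a j → adj switch a j ≡ adj G a j
    agree j≢b j≢c (deleted (inj₁ (inj₁ (_ , j≡b))) _)      = contradiction j≡b j≢b
    agree j≢b j≢c (deleted (inj₁ (inj₂ (a≡b , _))) _)      = contradiction a≡b (adj⇒≢ G ab)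
    agree j≢b j≢c (deleted (inj₂ aj-ce) _)                 = contradiction aj-ce
      (misses-both (proj₁ ac) (adj-nonAdj⇒≢ G (adj-symm G ab) be))
    agree j≢b j≢c (inserted _ _ (inj₁ (inj₁ (_ , j≡c))) _) = contradiction j≡c j≢c
    agree j≢b j≢c (inserted _ _ (inj₁ (inj₂ (a≡c , _))) _) = contradiction a≡c (proj₁ ac)
    agree j≢b j≢c (inserted _ _ (inj₂ aj-be) _)            = contradiction aj-be
      (misses-both (adj⇒≢ G ab) (adj-nonAdj⇒≢ G (adj-symm G ab) be))
    agree j≢b j≢c (kept _ _ _ _ eq)                        = eq

module _ (G : Graph n) {a b c e : Fin n} (s : Switchable G a b c e) where

  switch-deg : ∀ i → deg (switch G s) i ≡ deg G i
  switch-deg i = go (i ≟ a) (i ≟ b) (i ≟ c) (i ≟ e)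
    where
    go : Dec (i ≡ a) → Dec (i ≡ b) → Dec (i ≡ c) → Dec (i ≡ e) → deg (switch G s) i ≡ deg G i
    go (yes refl) _ _ _ = switch-deg-corner G s
    go _ (yes refl) _ _ =
      trans (#-cong (switchAdj-mirror G a b c e i)) (switch-deg-corner G (mirror s))
    go _ _ (yes refl) _ =
      trans (#-cong (switchAdj-rotate G a b c e i)) (switch-deg-corner G (rotate s))
    go _ _ _ (yes refl) =
      trans (#-cong (λ j → trans (switchAdj-rotate G a b c e i j) (switchAdj-mirror G c e a b i j)))
            (switch-deg-corner G (mirror (rotate s)))
    go (no i≢a) (no i≢b) (no i≢c) (no i≢e) = #-cong (switch-untouched G s i≢a i≢b i≢c i≢e)

-- u is the third vertex of the triangle that the switch destroys or creates.
data Apex (G : Graph n) (a b c e : Fin n) : Set where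
  over-ab : ∀ {u} → Adj G u a → Adj G u b → Apex G a b c e
  over-ac : ∀ {u} → Adj G u a → Adj G u c → ¬ u ≡ b → ¬ u ≡ e → Apex G a b c e
  over-be : ∀ {u} → Adj G u b → Adj G u e → ¬ u ≡ a → ¬ u ≡ c → Apex G a b c e

-- Apart from the two inequalities assumed for `u`, distinctness follows from `Switchable` and the
-- edges at `u`.
replaces⇒ΔPlus : (G H : Graph n) {u a b c e : Fin n} → Switchable G a b c e →
  Adj G u a → Adj G u c → ¬ u ≡ b → ¬ u ≡ e → Replaces G H a b c e a c b e → ΔPlus G H
replaces⇒ΔPlus G H {u} {a} {b} {c} {e} (switchable ab ce ac be) ua uc u≢b u≢e replaces =
  u , a , b , c , e
  , (adj⇒≢ G ua , u≢b , adj⇒≢ G uc , u≢e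
    , adj⇒≢ G ab , proj₁ ac , adj-nonAdj⇒≢ G (adj-symm G ab) be
    , adj-nonAdj⇒≢ G ab ac , proj₁ be , adj⇒≢ G ce)
  , adj-symm G ab , adj-symm G ua , uc , ce , proj₂ ac , proj₂ be , replaces

-- An apex over a deleted edge gives a Δ⁻-switch, an apex over an inserted edge a Δ⁺-switch.
switch-Δ : (G : Graph n) {a b c e : Fin n} (s : Switchable G a b c e) → Apex G a b c e →
  ΔSwitch G (switch G s)
switch-Δ G {a} {b} {c} {e} (switchable ab ce ac be) (over-ab {u} ua ub) =
  inj₂ (u , a , c , b , e
       , (adj⇒≢ G ua , adj-nonAdj⇒≢ G (adj-symm G ua) ac
         , adj⇒≢ G ub , adj-nonAdj⇒≢ G (adj-symm G ub) be
         , proj₁ ac , adj⇒≢ G ab , adj-nonAdj⇒≢ G (adj-symm G ab) be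
         , ≢-sym (adj-nonAdj⇒≢ G ab ac) , adj⇒≢ G ce , proj₁ be)
       , ua , ab , ub , ce , proj₂ ac , proj₂ be , λ _ _ → refl)
switch-Δ G s (over-ac ua uc u≢b u≢e) =
  inj₁ (replaces⇒ΔPlus G (switch G s) s ua uc u≢b u≢e λ _ _ → refl)
switch-Δ G {a} {b} {c} {e} s (over-be ub ue u≢a u≢c) =
  inj₁ (replaces⇒ΔPlus G (switch G s) (mirror s) ub ue u≢a u≢c (switchAdj-mirror G a b c e))

-- Exchange arguments in regular graphs

module _ (G : Graph n) (regular : Regular d G) where

  same-deg : ∀ a b → deg G a ≡ deg G b
  same-deg a b = trans (regular a) (sym (regular b))

  -- Taking `a` and `b` out of each other's neighbourhoods treats adjacent and non-adjacent pairs
  -- alike: both counts drop by one, or neither does. It also keeps `a` and `b` from being the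
  -- exchanged vertex.
  #-others : ∀ a b → # (adj G a ∖ b) ≡ # (adj G b ∖ a)
  #-others a b = go (adj G a b) refl
    where
    go : ∀ t → adj G a b ≡ t → # (adj G a ∖ b) ≡ # (adj G b ∖ a)
    go true ab = suc-injective (begin
      suc (# (adj G a ∖ b))  ≡⟨ sym (#-∖ (adj G a) ab) ⟩
      deg G a                ≡⟨ same-deg a b ⟩
      deg G b                ≡⟨ #-∖ (adj G b) (adj-symm G ab) ⟩
      suc (# (adj G b ∖ a))  ∎)
      where open ≡-Reasoning
    go false ab = begin
      # (adj G a ∖ b)  ≡⟨ #-cong (∖-absent (adj G a) ab) ⟩
      deg G a          ≡⟨ same-deg a b ⟩
      deg G b          ≡⟨ sym (#-cong (∖-absent (adj G b) (trans (adj-sym G b a) ab))) ⟩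
      # (adj G b ∖ a)  ∎
      where open ≡-Reasoning

  private
    exchanged : ∀ {a b e} → (adj G b ∖ a) e ≡ true → (adj G a ∖ b) e ≡ false → Adj G b e × NonAdj G a e
    exchanged {a} {b} be ae =
      let be′ , e≢a = ∈∖⁻ (adj G b) be
      in be′ , ≢-sym e≢a , ∉∖⁻ (adj G a) ae (≢-sym (adj⇒≢ G be′))

    private-neighbour : ∀ {a b c} → Adj G a c → NonAdj G b c →
      (adj G a ∖ b) c ≡ true × (adj G b ∖ a) c ≡ false
    private-neighbour {a} {b} ac (b≢c , bc) = ∈∖⁺ (adj G a) ac (≢-sym b≢c) , ∉∖⁺ (adj G b) bc

  exchange : ∀ {a b c} → Adj G a c → NonAdj G b c → ∃[ e ] (Adj G b e × NonAdj G a e)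
  exchange {a} {b} ac bc =
    let ac′ , bc′   = private-neighbour ac bc
        e , be , ae = #-exchange _ _ (#-others a b) ac′ bc′
    in e , exchanged be ae

  exchange₂ : ∀ {a b c c′} → ¬ c ≡ c′ → Adj G a c → NonAdj G b c → Adj G a c′ → NonAdj G b c′ →
    ∃[ e ] ∃[ e′ ] (¬ e ≡ e′ × (Adj G b e × NonAdj G a e) × (Adj G b e′ × NonAdj G a e′))
  exchange₂ {a} {b} c≢c′ ac bc ac′ bc′ =
    let p , q = private-neighbour ac bc
        r , s = private-neighbour ac′ bc′
        e , e′ , e≢e′ , (be , ae) , (be′ , ae′) = #-exchange₂ _ _ (#-others a b) c≢c′ p q r s
    in e , e′ , e≢e′ , exchanged be ae , exchanged be′ ae′

  exchange-avoiding : ∀ r {a b c c′} → ¬ c ≡ c′ →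
    Adj G a c → NonAdj G b c → Adj G a c′ → NonAdj G b c′ →
    ∃[ e ] (¬ r ≡ e × Adj G b e × NonAdj G a e)
  exchange-avoiding r c≢c′ ac bc ac′ bc′ with exchange₂ c≢c′ ac bc ac′ bc′
  ... | e , e′ , e≢e′ , new , new′ with r ≟ e
  ...   | yes refl = e′ , e≢e′ , new′
  ...   | no  r≢e  = e , r≢e , new

  -- The bound `3 ≤ d` enters the proof here.
  third-neighbour : 3 ≤ d → ∀ {y a b} → ¬ a ≡ b → Adj G y a → Adj G y b →
    ∃[ r ] (Adj G y r × ¬ r ≡ a × ¬ r ≡ b)
  third-neighbour 3≤d {y} {a} {b} a≢b ya yb =
    let r , yr        = #-inhabited (adj G y ∖ a ∖ b) (≤-pred (≤-pred (subst (3 ≤_) count 3≤d)))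
        yr′ , r≢b     = ∈∖⁻ (adj G y ∖ a) yr
        yr″ , r≢a     = ∈∖⁻ (adj G y) yr′
    in r , yr″ , r≢a , r≢b
    where
    open ≡-Reasoning
    count : d ≡ suc (suc (# (adj G y ∖ a ∖ b)))
    count = begin
      d                                ≡⟨ sym (regular y) ⟩
      deg G y                          ≡⟨ #-∖ (adj G y) ya ⟩
      suc (# (adj G y ∖ a))            ≡⟨ cong suc (#-∖ (adj G y ∖ a) (∈∖⁺ (adj G y) yb (≢-sym a≢b))) ⟩
      suc (suc (# (adj G y ∖ a ∖ b)))  ∎

  -- The two closed neighbourhoods have `d + 1` elements each and share `x`, so together they cover
  -- at most `2 * d + 1` vertices.
  outside-both : 2 * (d + 1) ≤ n → ∀ {a b x} → Adj G a x → Adj G b x →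
    ∃[ p ] (NonAdj G a p × NonAdj G b p)
  outside-both large {a} {b} {x} ax bx
    with any? (λ p → ¬? (closed G a p Bool.≟ true) ×-dec ¬? (closed G b p Bool.≟ true))
  ... | yes (p , ¬ap , ¬bp) = p , closed-false G ¬ap , closed-false G ¬bp
  ... | no  none = contradiction (begin-strict
          n                                     ≤⟨ #-cover _ _ covered ⟩
          # (closed G a) + # (closed G b ∖ x)   ≡⟨ cong₂ _+_ (trans (#-closed G a) (cong suc (regular a))) rest ⟩
          suc d + d                             <⟨ ≤-reflexive arith ⟩
          2 * (d + 1)                           ≤⟨ large ⟩
          n                                     ∎) (<-irrefl refl)
    where
    open ≤-Reasoning
    adj⇒closed : ∀ {a j} → Adj G a j → closed G a j ≡ true
    adj⇒closed aj rewrite aj = refl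
    rest : # (closed G b ∖ x) ≡ d
    rest = suc-injective (trans (sym (#-∖ (closed G b) (adj⇒closed bx)))
             (trans (#-closed G b) (cong suc (regular b))))
    arith : suc (suc d + d) ≡ 2 * (d + 1)
    arith = solve 1 (λ d → con 1 :+ (con 1 :+ d :+ d) := con 2 :* (d :+ con 1)) refl d
      where open +-*-Solver
    covered : ∀ j → closed G a j ≡ true ⊎ (closed G b ∖ x) j ≡ true
    covered j with closed G a j in aj
    ... | true  = inj₁ refl
    ... | false with closed G b j Bool.≟ true
    ...   | yes bj = inj₂ (∈∖⁺ (closed G b) bj (λ { refl → separated (closed G a) (adj⇒closed ax) aj refl }))
    ...   | no ¬bj = contradiction (j , (λ aj′ → separated (closed G a) aj′ aj refl) , ¬bj) none

-- The neighbourhood of v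

module Centre {n d : ℕ} (3≤d : 3 ≤ d) (large : 2 * (d + 1) ≤ n) (v : Fin n) where

  -- The last two fields make steps composable: pairs of N(v) that are already joined stay joined.
  record Progress (G H : Graph n) : Set where
    field
      path    : ΔSwitches G H
      regular : Regular d H
      centre  : ∀ a → adj H v a ≡ adj G v a
      keeps   : ∀ {a b} → Adj G v a → Adj G v b → Adj G a b → Adj H a b

  open Progress

  progress-refl : ∀ {G} → Regular d G → Progress G G
  progress-refl R = record { path = ε ; regular = R ; centre = λ _ → refl ; keeps = λ _ _ ab → ab }

  progress-trans : ∀ {G H K} → Progress G H → Progress H K → Progress G K
  progress-trans P Q = record
    { path    = path P ◅◅ path Q
    ; regular = regular Q
    ; centre  = λ a → trans (centre Q a) (centre P a)
    ; keeps   = λ {a} {b} va vb ab →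
        keeps Q (trans (centre P a) va) (trans (centre P b) vb) (keeps P va vb ab)
    }

  private
    outer : ∀ (G : Graph n) {p q a b} → Adj G v p → Adj G v q → NonAdj G v a ⊎ NonAdj G v b → ¬ SamePair p q a b
    outer G vp vq (inj₁ va) = misses-first (adj-nonAdj⇒≢ G vp va) (adj-nonAdj⇒≢ G vq va)
    outer G vp vq (inj₂ vb) = misses-second (adj-nonAdj⇒≢ G vp vb) (adj-nonAdj⇒≢ G vq vb)

    off-centre : ∀ (G : Graph n) {a b} → Adj G a b → NonAdj G v a ⊎ NonAdj G v b → (¬ v ≡ a) × (¬ v ≡ b)
    off-centre G ab (inj₁ va) = proj₁ va , ≢-sym (adj-nonAdj⇒≢ G ab (nonAdj-symm G va))
    off-centre G ab (inj₂ vb) = ≢-sym (adj-nonAdj⇒≢ G (adj-symm G ab) (nonAdj-symm G vb)) , proj₁ vb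

  -- A deleted edge with an outer end lies neither inside N(v) nor at `v`. Every corner is an end of
  -- a deleted edge, so `v` is untouched.
  switch-progress : (G : Graph n) → Regular d G → ∀ {a b c e} (s : Switchable G a b c e) → Apex G a b c e →
    NonAdj G v a ⊎ NonAdj G v b → NonAdj G v c ⊎ NonAdj G v e → Progress G (switch G s)
  switch-progress G R s@(switchable ab ce ac be) apex out out′ = record
    { path    = switch-Δ G s apex ◅ ε
    ; regular = λ i → trans (switch-deg G s i) (R i)
    ; centre  =
        let v≢a , v≢b = off-centre G ab out
            v≢c , v≢e = off-centre G ce out′
        in switch-untouched G s v≢a v≢b v≢c v≢e
    ; keeps   = λ vp vq pq → switch-keeps-adj G s pq (outer G vp vq out) (outer G vp vq out′)
    }

  centre-nonAdj : ∀ {G H p} → Progress G H → NonAdj G v p → NonAdj H v p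
  centre-nonAdj P (v≢p , vp) = v≢p , trans (centre P _) vp

  -- Joining one pair: configurations and basic moves

  Improvement : Graph n → Fin n → Fin n → Set
  Improvement G x w = ∃[ H ] (Progress G H × Adj H x w)

  improvement-symm : ∀ {G x w} → Improvement G w x → Improvement G x w
  improvement-symm (H , P , wx) = H , P , adj-symm H wx

  improve-after : ∀ {G H x w} → Progress G H → Improvement H x w → Improvement G x w
  improve-after P (K , Q , xw) = K , progress-trans P Q , xw

  -- The outer neighbours `y` and `z` may coincide.
  record Config (G : Graph n) (x y w z : Fin n) : Set where
    constructor config
    field
      vx  : Adj G v x
      vw  : Adj G v w
      xw  : NonAdj G x w
      vy  : NonAdj G v y
      vz  : NonAdj G v z
      xy  : Adj G x y
      wz  : Adj G w z

  flip-config : ∀ {G x y w z} → Config G x y w z → Config G w z x y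
  flip-config {G} (config vx vw xw vy vz xy wz) = config vw vx (nonAdj-symm G xw) vz vy wz xy

  module _ (G : Graph n) (R : Regular d G) where

    near≢far : ∀ {p q} → Adj G v p → NonAdj G v q → ¬ p ≡ q
    near≢far = adj-nonAdj⇒≢ G

    ≢-centre : ∀ {a b} → NonAdj G v a → Adj G a b → ¬ v ≡ b
    ≢-centre va ab = ≢-sym (adj-nonAdj⇒≢ G ab (nonAdj-symm G va))

    -- The path `y x v w z` carries a Δ⁺-switch with apex `v`.
    close : ∀ {x y w z} → Config G x y w z → NonAdj G y z → Improvement G x w
    close (config vx vw xw vy vz xy wz) yz =
      let s = switchable xy wz xw yz
      in switch G s
       , switch-progress G R s (over-ac vx vw (proj₁ vy) (proj₁ vz)) (inj₂ vy) (inj₂ vz)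
       , switch-inserts G s

    -- x trades its outer neighbour y for q; no edge inside N(v) is lost.
    reroute : ∀ {x y w z p q} → Config G x y w z → NonAdj G v q → NonAdj G x q → NonAdj G y p → Adj G q p →
      ¬ SamePair w z q p → Apex G x y q p →
      ∃[ H ] (Progress G H × Config H x q w z × (NonAdj G q z → NonAdj H q z))
    reroute {x} {y} {w} {z} {p} {q} (config vx vw xw vy vz xy wz) vq xq yp qp wz≢qp apex =
      H , P
      , config (trans (centre P x) vx) (trans (centre P w) vw)
          (switch-keeps-nonAdj G s xw
            (misses-second (near≢far vx vq) (near≢far vw vq))
            (misses-first (near≢far vx vy) (near≢far vw vy)))
          (centre-nonAdj {G} P vq) (centre-nonAdj {G} P vz)
          (switch-inserts G s)
          (switch-keeps-adj G s wz (misses-first (≢-sym (proj₁ xw)) (≢-sym (near≢far vx vz))) wz≢qp)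
      , λ qz → switch-keeps-nonAdj G s qz
          (misses-first (≢-sym (proj₁ xq)) (≢-sym (near≢far vx vz)))
          (misses-both (≢-sym (adj-nonAdj⇒≢ G xy xq)) (adj⇒≢ G qp))
      where
      s : Switchable G x y q p
      s = switchable xy qp xq yp
      H : Graph n
      H = switch G s
      P : Progress G H
      P = switch-progress G R s apex (inj₂ vy) (inj₁ vq)

  -- Adjacent outer neighbours

  module _ (G : Graph n) (R : Regular d G) where

    -- The switch removes the edge `y z` and keeps `x y` and `w z`, after which `close` applies.
    separate : ∀ {x y w z p q} → Config G x y w z → Adj G y z → NonAdj G v p → NonAdj G y p → NonAdj G z q →
      Adj G p q → Apex G y z p q → Improvement G x w
    separate {x} {y} {w} {z} {p} {q} (config vx vw xw vy vz xy wz) yz vp yp zq pq apex =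
      improve-after P (close H (regular P)
        (config (trans (centre P x) vx) (trans (centre P w) vw)
          (switch-keeps-nonAdj G s xw
            (misses-first (near≢far G R vx vy) (near≢far G R vw vy))
            (misses-first (near≢far G R vx vz) (near≢far G R vw vz)))
          (centre-nonAdj {G} P vy) (centre-nonAdj {G} P vz)
          (switch-keeps-adj G s xy
            (misses-both (near≢far G R vx vy) (near≢far G R vx vz))
            (misses-first (near≢far G R vx vp) (proj₁ yp)))
          (switch-keeps-adj G s wz
            (misses-both (near≢far G R vw vy) (near≢far G R vw vz))
            (misses-first (near≢far G R vw vp) (adj-nonAdj⇒≢ G yz yp))))
        (switch-deletes G s))
      where
      s : Switchable G y z p q
      s = switchable yz pq yp zq
      H : Graph n
      H = switch G s
      P : Progress G H
      P = switch-progress G R s apex (inj₁ vy) (inj₁ vp)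

    separate-common : ∀ {x y w z r} → Config G x y w z → Adj G y z → Adj G r y → Adj G r z → Improvement G x w
    separate-common C@(config vx vw xw vy vz xy wz) yz ry rz =
      let p , vp , yp = outside-both G R large vx (adj-symm G xy)
          -- `z` has the neighbour `y` outside N[p], so `p` has a neighbour outside N[z].
          q , pq , zq = exchange G R (adj-symm G yz) (nonAdj-symm G yp)
      in separate C yz vp yp zq pq (over-ab ry rz)

    separate-distance-two : ∀ {x y w z r p} → Config G x y w z → Adj G y z →
      Adj G r y → ¬ r ≡ z → Adj G r p → NonAdj G y p → NonAdj G v p → Improvement G x w
    separate-distance-two {x} {y} {w} {z} {r} {p} C@(config vx vw xw vy vz xy wz) yz ry r≢z rp yp vp
      with adj-or-nonAdj G (near≢far G R vw vp)
    -- Here `p` can replace `z` as the outer neighbour of `w`.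
    ... | inj₁ wp = close G R (config vx vw xw vy vp xy wp) yp
    ... | inj₂ wp =
      -- Both `y` and `w` are neighbours of `z` outside N[p]. This gives two candidates for `q`, one
      -- of which differs from the apex `r`.
      let q , r≢q , pq , zq = exchange-avoiding G R r (≢-sym (near≢far G R vw vy))
            (adj-symm G yz) (nonAdj-symm G yp) (adj-symm G wz) (nonAdj-symm G wp)
      in separate C yz vp yp zq pq (over-ac ry rp r≢z r≢q)

    Sole : Fin n → Fin n → Set
    Sole x y = ∀ u → NonAdj G v u → Adj G x u → u ≡ y

    sole? : ∀ x y → (∃[ u ] (NonAdj G v u × Adj G x u × ¬ u ≡ y)) ⊎ Sole x y
    sole? x y with any? (λ u → (¬? (v ≟ u) ×-dec (adj G v u Bool.≟ false))
                               ×-dec ((adj G x u Bool.≟ true) ×-dec ¬? (u ≟ y)))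
    ... | yes found = inj₁ found
    ... | no  none  = inj₂ λ u vu xu → decidable-stable (u ≟ y) λ u≢y → none (u , vu , xu , u≢y)

    -- If `x` missed `t` as well as `w`, then `v` would have two neighbours outside N[x], so `x`
    -- would have two outer neighbours.
    sole-full : ∀ {x y w t} → Sole x y → Adj G v w → NonAdj G x w → Adj G v t → ¬ x ≡ t → ¬ w ≡ t → Adj G x t
    sole-full sole vw xw vt x≢t w≢t with adj-or-nonAdj G x≢t
    ... | inj₁ xt = xt
    ... | inj₂ xt =
      let e , e′ , e≢e′ , (xe , ve) , (xe′ , ve′) = exchange₂ G R w≢t vw xw vt xt
      in contradiction (trans (sole e ve xe) (sym (sole e′ ve′ xe′))) e≢e′

    -- A second outer neighbour `u` of `x` replaces `y` if it is not adjacent to `z`. Otherwise `y`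
    -- and `z` have a common neighbour (`x` or `u`), or `u` is at distance two from `y` through `x`.
    sole-or-improve : ∀ {x y w z} → Config G x y w z → Adj G y z → Improvement G x w ⊎ Sole x y
    sole-or-improve {x} {y} {w} {z} C@(config vx vw xw vy vz xy wz) yz with sole? x y
    ... | inj₂ sole = inj₂ sole
    ... | inj₁ (u , vu , xu , u≢y) with u ≟ z
    ...   | yes refl = inj₁ (separate-common C yz xy xu)
    ...   | no  u≢z with adj-or-nonAdj G u≢z | adj-or-nonAdj G (≢-sym u≢y)
    ...     | inj₂ uz | _       = inj₁ (close G R (config vx vw xw vu vz xu wz) uz)
    ...     | inj₁ uz | inj₁ yu = inj₁ (separate-common C yz (adj-symm G yu) uz)
    ...     | inj₁ _  | inj₂ yu = inj₁ (separate-distance-two C yz xy (near≢far G R vx vz) xu yu vu)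

    -- The position of `q` decides. If `q` is in N(v), then `w` is adjacent to `z` and `q` and is
    -- the apex of a switch that deletes `y z`. If `q` is outer, `r` is adjacent to `x` and `y` and
    -- is the apex of a switch that trades `y` for `q`.
    improve-adj-near : ∀ {x y w z r} → Config G x y w z → Adj G y z → Sole x y → Sole w z →
      Adj G y r → ¬ r ≡ x → NonAdj G r z → Adj G v r → Improvement G x w
    improve-adj-near {x} {y} {w} {z} {r} C@(config vx vw xw vy vz xy wz) yz solex solew yr r≢x rz vr
      with outside-both G R large vx (adj-symm G xy)
    ... | p , vp , yp with exchange G R (adj-symm G yz) (nonAdj-symm G yp)
    ...   | q , pq , zq = finish (adj-or-nonAdj G (≢-centre G R vp pq))
      where
      ¬xp : ¬ Adj G x p
      ¬xp xp = proj₁ yp (sym (solex p vp xp))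
      x≢q : ¬ x ≡ q
      x≢q refl = ¬xp (adj-symm G pq)
      w≢q : ¬ w ≡ q
      w≢q = adj-nonAdj⇒≢ G (adj-symm G wz) zq
      finish : Adj G v q ⊎ NonAdj G v q → Improvement G x w
      finish (inj₁ vq) = separate C yz vp yp zq pq
        (over-be wz (sole-full solew vx (nonAdj-symm G xw) vq w≢q x≢q) (near≢far G R vw vy) (near≢far G R vw vp))
      finish (inj₂ vq) with adj-or-nonAdj G x≢q
      ... | inj₁ xq = contradiction (solex q vq xq)
                        (adj-nonAdj⇒≢ G pq (nonAdj-symm G yp))
      ... | inj₂ xq
        with reroute G R C vq xq yp (adj-symm G pq)
               (misses-first w≢q (proj₁ zq))
               (over-ab (adj-symm G xr) (adj-symm G yr))
        where
        xr : Adj G x r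
        xr = sole-full solex vw xw vr (≢-sym r≢x) (adj-nonAdj⇒≢ G (adj-symm G wz) (nonAdj-symm G rz))
      ...   | H , P , C′ , qz = improve-after P (close H (regular P) C′ (qz (nonAdj-symm G zq)))

    -- `y` has the neighbours `x` and `z` outside N[r], so `r` has two neighbours outside N[y]. If
    -- one of them is outer, it is at distance two from `y` through `r`. If both are in N(v), one is
    -- the apex of a switch that trades `y` for `r`, and the other is joined to `y`.
    improve-adj-far : ∀ {x y w z r} → Config G x y w z → Adj G y z → Sole x y → Sole w z →
      Adj G y r → NonAdj G r z → NonAdj G v r → Improvement G x w
    improve-adj-far {x} {y} {w} {z} {r} C@(config vx vw xw vy vz xy wz) yz solex solew yr rz vr
      with adj-or-nonAdj G (near≢far G R vx vr)
    ... | inj₁ xr = contradiction (sym (solex r vr xr)) (adj⇒≢ G yr)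
    ... | inj₂ xr
      with exchange₂ G R (≢-sym (near≢far G R vx vz)) yz rz (adj-symm G xy) (nonAdj-symm G xr)
    ...   | p , p′ , p≢p′ , (rp , yp) , (rp′ , yp′) =
      finish (adj-or-nonAdj G (≢-centre G R vr rp)) (adj-or-nonAdj G (≢-centre G R vr rp′))
      where
      w≢ : ∀ {p} → Adj G r p → ¬ w ≡ p
      w≢ rp refl = proj₁ rz (solew r vr (adj-symm G rp))
      finish : Adj G v p ⊎ NonAdj G v p → Adj G v p′ ⊎ NonAdj G v p′ → Improvement G x w
      finish (inj₂ vp) _ = separate-distance-two C yz (adj-symm G yr) (proj₁ rz) rp yp vp
      finish _ (inj₂ vp′) = separate-distance-two C yz (adj-symm G yr) (proj₁ rz) rp′ yp′ vp′
      finish (inj₁ vp) (inj₁ vp′)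
        with reroute G R C vr xr yp rp
               (misses-first (near≢far G R vw vr) (≢-sym (proj₁ rz)))
               (over-ac (adj-symm G (sole-full solex vw xw vp′ (adj-nonAdj⇒≢ G (adj-symm G xy) yp′) (w≢ rp′)))
                        (adj-symm G rp′) (≢-sym (proj₁ yp′)) (≢-sym p≢p′))
      ... | H , P , C′ , keep = improve-after P (close H (regular P) C′ (keep rz))

    improve-adj : ∀ {x y w z} → Config G x y w z → Adj G y z → Improvement G x w
    improve-adj {x} {y} {w} {z} C@(config vx vw xw vy vz xy wz) yz
      with sole-or-improve C yz | sole-or-improve (flip-config C) (adj-symm G yz)
    ... | inj₁ done  | _          = done
    ... | inj₂ _     | inj₁ done  = improvement-symm done
    ... | inj₂ solex | inj₂ solew
      with third-neighbour G R 3≤d (near≢far G R vx vz) (adj-symm G xy) yz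
    ...   | r , yr , r≢x , r≢z with adj-or-nonAdj G r≢z
    ...     | inj₁ rz = separate-common C yz (adj-symm G yr) rz
    ...     | inj₂ rz with adj-or-nonAdj G (≢-centre G R vy yr)
    ...       | inj₁ vr = improve-adj-near C yz solex solew yr r≢x rz vr
    ...       | inj₂ vr = improve-adj-far C yz solex solew yr rz vr

  improve-distinct : (G : Graph n) → Regular d G → ∀ {x y w z} → Config G x y w z → ¬ y ≡ z → Improvement G x w
  improve-distinct G R C y≢z with adj-or-nonAdj G y≢z
  ... | inj₁ yz = improve-adj G R C yz
  ... | inj₂ yz = close G R C yz

  -- A shared outer neighbour

  module _ (G : Graph n) (R : Regular d G) where

    -- After the switch `x` has the outer neighbour `q` while `w` keeps `y`, so the case of distinct
    -- outer neighbours applies.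
    reroute-improve : ∀ {x y w p q} → Config G x y w y → NonAdj G v q → Sole G R x y → NonAdj G y p → Adj G q p →
      Apex G x y q p → Improvement G x w
    reroute-improve {x} {y} {w} {p} {q} C@(config vx vw xw vy _ xy wy) vq solex yp qp apex
      with adj-or-nonAdj G (near≢far G R vx vq)
    ... | inj₁ xq = contradiction (solex q vq xq) (adj-nonAdj⇒≢ G (adj-symm G qp) (nonAdj-symm G yp))
    ... | inj₂ xq
      with reroute G R C vq xq yp qp
             (misses-second (adj-nonAdj⇒≢ G (adj-symm G wy) yp) (proj₁ yp)) apex
    ...   | H , P , C′ , _ = improve-after P (improve-distinct H (regular P) C′
            (adj-nonAdj⇒≢ G (adj-symm G qp) (nonAdj-symm G yp)))

    -- The edge `p q` has both ends outside N[y]. The switch gives an outer end to `x` and the other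
    -- end to `y`; its apex `r` is adjacent to `x` and `y`.
    improve-shared-near : ∀ {x y w r} → Config G x y w y → Sole G R x y →
      Adj G y r → ¬ r ≡ x → ¬ r ≡ w → Adj G v r → Improvement G x w
    improve-shared-near {x} {y} {w} {r} C@(config vx vw xw vy _ xy wy) solex yr r≢x r≢w vr
      with outside-both G R large vx (adj-symm G xy)
    ... | p , vp , yp with adj-or-nonAdj G (near≢far G R vx vp)
    ...   | inj₁ xp = contradiction (sym (solex p vp xp)) (proj₁ yp)
    ...   | inj₂ xp with exchange G R (adj-symm G xy) (nonAdj-symm G xp)
    ...     | q , pq , yq = finish (adj-or-nonAdj G (≢-centre G R vp pq))
      where
      apex : ∀ {p q} → Apex G x y q p
      apex = over-ab (adj-symm G (sole-full G R solex vw xw vr (≢-sym r≢x) (≢-sym r≢w))) (adj-symm G yr)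
      finish : Adj G v q ⊎ NonAdj G v q → Improvement G x w
      finish (inj₁ vq) = reroute-improve C vp solex yq pq apex
      finish (inj₂ vq) = reroute-improve C vq solex yp (adj-symm G pq) apex

    improve-shared-far : ∀ {x y w r} → Config G x y w y → Sole G R x y → Sole G R w y →
      Adj G y r → ¬ r ≡ x → ¬ r ≡ w → NonAdj G v r → Improvement G x w
    improve-shared-far {x} {y} {w} {r} C@(config vx vw xw vy _ xy wy) solex solew yr r≢x r≢w vr
      -- Since `y` is the only outer neighbour of `x` and of `w`, both lie outside N[r], so `r` has
      -- two neighbours outside N[y].
      with exchange₂ G R (proj₁ xw) (adj-symm G xy) (r≁ solex vx) (adj-symm G wy) (r≁ solew vw)
      where
      r≁ : ∀ {t} → Sole G R t y → Adj G v t → NonAdj G r t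
      r≁ sole vt with adj-or-nonAdj G (near≢far G R vt vr)
      ... | inj₁ tr = contradiction (sym (sole r vr tr)) (adj⇒≢ G yr)
      ... | inj₂ tr = nonAdj-symm G tr
    ... | p , p′ , p≢p′ , (rp , yp) , (rp′ , yp′) =
      finish (adj-or-nonAdj G (≢-centre G R vr rp)) (adj-or-nonAdj G (≢-centre G R vr rp′))
      where
      via-far : ∀ {p} → Adj G r p → NonAdj G y p → NonAdj G v p → Improvement G x w
      via-far {p} rp yp vp =
        -- An outer `p` misses `x` and `w`, which gives `p` two outer neighbours; the one that
        -- differs from the apex `r` goes to `x`.
        let q , r≢q , pq , vq = exchange-avoiding G R r (proj₁ xw) vx (p≁ solex vx) vw (p≁ solew vw)
        in reroute-improve C vq solex yp (adj-symm G pq) (over-be (adj-symm G yr) rp r≢x r≢q)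
        where
        p≁ : ∀ {t} → Sole G R t y → Adj G v t → NonAdj G p t
        p≁ sole vt with adj-or-nonAdj G (near≢far G R vt vp)
        ... | inj₁ tp = contradiction (sym (sole p vp tp)) (proj₁ yp)
        ... | inj₂ tp = nonAdj-symm G tp
      finish : Adj G v p ⊎ NonAdj G v p → Adj G v p′ ⊎ NonAdj G v p′ → Improvement G x w
      finish (inj₂ vp) _          = via-far rp yp vp
      finish _         (inj₂ vp′) = via-far rp′ yp′ vp′
      finish (inj₁ _)  (inj₁ vp′) =
        reroute-improve C vr solex yp rp
          (over-ac (adj-symm G (sole-full G R solex vw xw vp′
                     (adj-nonAdj⇒≢ G (adj-symm G xy) yp′) (adj-nonAdj⇒≢ G (adj-symm G wy) yp′)))
                   (adj-symm G rp′) (≢-sym (proj₁ yp′)) (≢-sym p≢p′))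

    improve-shared : ∀ {x y w} → Config G x y w y → Sole G R x y → Sole G R w y → Improvement G x w
    improve-shared C@(config vx vw xw vy _ xy wy) solex solew
      with third-neighbour G R 3≤d (proj₁ xw) (adj-symm G xy) (adj-symm G wy)
    ... | r , yr , r≢x , r≢w with adj-or-nonAdj G (≢-centre G R vy yr)
    ...   | inj₁ vr = improve-shared-near C solex yr r≢x r≢w vr
    ...   | inj₂ vr = improve-shared-far C solex solew yr r≢x r≢w vr

    improve : ∀ {x w} → Adj G v x → Adj G v w → NonAdj G x w → Improvement G x w
    improve {x} {w} vx vw xw
      with exchange G R vw xw | exchange G R vx (nonAdj-symm G xw)
    -- Look for an outer neighbour of `x` other than `z`, or of `w` other than `y`. If there is
    -- none, `y` and `z` coincide.
    ... | y , xy , vy | z , wz , vz with sole? G R x z | sole? G R w y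
    ...   | inj₁ (u , vu , xu , u≢z) | _ = improve-distinct G R (config vx vw xw vu vz xu wz) u≢z
    ...   | inj₂ _ | inj₁ (u , vu , wu , u≢y) =
            improve-distinct G R (config vx vw xw vy vu xy wu) (≢-sym u≢y)
    ...   | inj₂ solex | inj₂ solew with solex y vy xy
    ...     | refl = improve-shared (config vx vw xw vy vz xy wz) solex solew

  -- Joining all pairs

  Joined : Graph n → Fin n × Fin n → Set
  Joined G (a , b) = Adj G v a → Adj G v b → ¬ a ≡ b → Adj G a b

  joined-preserved : ∀ {G H ab} → Progress G H → Joined G ab → Joined H ab
  joined-preserved P joined va vb a≢b =
    let va′ = trans (sym (centre P _)) va
        vb′ = trans (sym (centre P _)) vb
    in keeps P va′ vb′ (joined va′ vb′ a≢b)

  join : (G : Graph n) → Regular d G → ∀ a b → ∃[ H ] (Progress G H × Joined H (a , b))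
  join G R a b
    with (adj G v a Bool.≟ true) ×-dec (adj G v b Bool.≟ true) ×-dec ¬? (a ≟ b) ×-dec (adj G a b Bool.≟ false)
  ... | yes (va , vb , a≢b , ab) =
    let H , P , ab′ = improve G R va vb (a≢b , ab) in H , P , λ _ _ _ → ab′
  ... | no  settled = G , progress-refl R , λ va vb a≢b →
    Bool.¬-not λ ab → settled (va , vb , a≢b , ab)

  join-all : (G : Graph n) → Regular d G → (ps : List (Fin n × Fin n)) →
    ∃[ H ] (Progress G H × All (Joined H) ps)
  join-all G R []             = G , progress-refl R , []
  join-all G R ((a , b) ∷ ps) =
    let H , P , joined = join G R a b
        K , Q , rest   = join-all H (regular P) ps
    in K , progress-trans P Q , joined-preserved {H} {K} Q joined ∷ rest

  joined⇒completeComponent : ∀ {G H} → Progress G H → (∀ a b → Joined H (a , b)) →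
    CompleteComponent H (InClosedNbhd G v)
  joined⇒completeComponent {G} {H} P joined = complete , isolated
    where
    near : ∀ {a} → Adj G v a → Adj H v a
    near va = trans (centre P _) va
    complete : ∀ a b → InClosedNbhd G v a → InClosedNbhd G v b → ¬ a ≡ b → Adj H a b
    complete a b (inj₁ refl) (inj₁ refl) a≢b = contradiction refl a≢b
    complete a b (inj₁ refl) (inj₂ vb)   a≢b = near vb
    complete a b (inj₂ va)   (inj₁ refl) a≢b = adj-symm H (near va)
    complete a b (inj₂ va)   (inj₂ vb)   a≢b = joined a b (near va) (near vb) a≢b
    isolated : ∀ a b → InClosedNbhd G v a → ¬ InClosedNbhd G v b → adj H a b ≡ false
    isolated a b a∈ b∉ = Bool.¬-not λ ab → escape a∈ ab
      where
      vb : NonAdj H v b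
      vb = (λ { refl → b∉ (inj₁ refl) })
         , Bool.¬-not λ vb → b∉ (inj₂ (trans (sym (centre P b)) vb))
      escape : InClosedNbhd G v a → ¬ Adj H a b
      escape (inj₁ refl) ab = adj-nonAdj⇒≢ H ab vb refl
      escape (inj₂ va)   ab =
        -- An edge leaving N[v] at `a` would give `v` a neighbour outside N[a], but `a` is already
        -- joined to all of N(v).
        let c , vc , a≢c , ac = exchange H (regular P) ab vb
        in separated (adj H a) (joined a c (near va) vc a≢c) ac refl

theorem3p1 : (d n : ℕ) → 3 ≤ d → 2 * (d + 1) ≤ n →
    (G : Graph n) → Regular d G → (v : Fin n) →
    ∃[ G' ] (ΔSwitches G G' × Regular d G' × CompleteComponent G' (InClosedNbhd G v))
theorem3p1 d n 3≤d large G R v =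
  let H , P , joined = join-all G R (cartesianProduct (allFin n) (allFin n))
  in H , path P , regular P
   , joined⇒completeComponent {G} {H} P λ a b →
       All.lookup joined (∈-cartesianProduct⁺ (∈-allFin a) (∈-allFin b))
  where
  open Centre 3≤d large v
  open Progress
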